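{- For all rational numbers $m,t$, define $$\begin{aligned} x_1&=2m^2-6t(t-2)m+6(t-1)(t+2)(3t-2),\\ x_2&=m^2t+16(t-1)m-3t(t+2)(3t-2),\\ x_3&=(2t-2)m^2-2(3t^2-4t+4)m-6(t+2)(3t-2),\\ y_1&=(2t-2)m^2-6t(t-2)m+6(t+2)(3t-2),\\ y_2&=m^2t-16(t-1)m-3t(t+2)(3t-2),\\ y_3&=2m^2+2(3t^2-4t+4)m-6(t-1)(t+2)(3t-2), \end{aligned}$$ and $x_4=-x_3$, $x_5=-x_2$, $x_6=-x_1$, $y_4=-y_3$, $y_5=-y_2$, $y_6=-y_1$. Then $$\sum_{i=1}^6x_i^r=\sum_{i=1}^6y_i^r\qquad\text{for } r=1,2,3,4,5.$$ Moreover, as a parametric solution this is nontrivial: in $\mathbb{Q}[m,t]$ the multisets $\{x_1,\dots,x_6\}$ and $\{y_1,\dots,y_6\}$ are distinct.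
   Context: An ideal solution of the Tarry-Escott problem of degree $k$ consists of two distinct multisets $\{x_1,\dots,x_{k+1}\}$, $\{y_1,\dots,y_{k+1}\}$ with $\sum x_i^r=\sum y_i^r$ for $r=1,\dots,k$. -}

module Defs where

open import Algebra.Bundles using (CommutativeRing; AbelianGroup)
import Algebra.Properties.Semiring.Exp
import Algebra.Properties.Semiring.Mult
import Algebra.Properties.CommutativeSemigroup
open import Agda.Builtin.FromNat using (Number; fromNat)
open import Data.List.Base using (List; []; _∷_; map; foldr)
open import Data.Nat.Base using (ℕ; zero; suc)
open import Data.Product.Base using (_,_)
open import Data.Rational.Properties using () renaming (+-*-commutativeRing to ℚ-commutativeRing) public
open import Data.Unit.Polymorphic.Base using (⊤; tt)
import Relation.Binary.Reasoning.Setoid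

-- Univariate polynomials over R, as lists of coefficients (constant term
-- first).  Trailing zeros are allowed, so equality is coefficientwise.

module Polynomial {c ℓ} (R : CommutativeRing c ℓ) where

  open CommutativeRing R
  open import Algebra.Properties.Ring ring using (-0#≈0#)

  Poly : Set c
  Poly = List Carrier

  coeff : Poly → ℕ → Carrier
  coeff []      _       = 0#
  coeff (a ∷ _) zero    = a
  coeff (_ ∷ p) (suc n) = coeff p n

  infix 4 _≈ₚ_

  record _≈ₚ_ (p q : Poly) : Set ℓ where
    constructor mk≈
    field at : ∀ n → coeff p n ≈ coeff q n

  open _≈ₚ_ public

  infixl 6 _+ₚ_
  infixl 7 _*ₚ_ _·_
  infix  8 -ₚ_

  _+ₚ_ : Poly → Poly → Poly
  []      +ₚ q       = q
  (a ∷ p) +ₚ []      = a ∷ p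
  (a ∷ p) +ₚ (b ∷ q) = a + b ∷ p +ₚ q

  -ₚ_ : Poly → Poly
  -ₚ p = map (λ a → - a) p

  _·_ : Carrier → Poly → Poly
  a · p = map (a *_) p

  _*ₚ_ : Poly → Poly → Poly
  []      *ₚ q = []
  (a ∷ p) *ₚ q = a · q +ₚ (0# ∷ p *ₚ q)

  constant : Carrier → Poly
  constant a = a ∷ []

  0ₚ 1ₚ X : Poly
  0ₚ = []
  1ₚ = constant 1#
  X  = 0# ∷ 1# ∷ []

  coeff-+ : ∀ p q n → coeff (p +ₚ q) n ≈ coeff p n + coeff q n
  coeff-+ []      q       n       = sym (+-identityˡ _)
  coeff-+ (a ∷ p) []      n       = sym (+-identityʳ _)
  coeff-+ (a ∷ p) (b ∷ q) zero    = refl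
  coeff-+ (a ∷ p) (b ∷ q) (suc n) = coeff-+ p q n

  coeff-neg : ∀ p n → coeff (-ₚ p) n ≈ - coeff p n
  coeff-neg []      n       = sym -0#≈0#
  coeff-neg (a ∷ p) zero    = refl
  coeff-neg (a ∷ p) (suc n) = coeff-neg p n

  coeff-· : ∀ a p n → coeff (a · p) n ≈ a * coeff p n
  coeff-· a []      n       = sym (zeroʳ a)
  coeff-· a (b ∷ p) zero    = refl
  coeff-· a (b ∷ p) (suc n) = coeff-· a p n

  +ₚ-abelianGroup : AbelianGroup c ℓ
  +ₚ-abelianGroup = record
    { Carrier = Poly ; _≈_ = _≈ₚ_ ; _∙_ = _+ₚ_ ; ε = 0ₚ ; _⁻¹ = -ₚ_
    ; isAbelianGroup = record
      { isGroup = record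
        { isMonoid = record
          { isSemigroup = record
            { isMagma = record
              { isEquivalence = record
                { refl  = mk≈ λ _ → refl
                ; sym   = λ e → mk≈ λ n → sym (at e n)
                ; trans = λ e f → mk≈ λ n → trans (at e n) (at f n)
                }
              ; ∙-cong = λ {p} {p′} {q} {q′} e f → mk≈ λ n →
                  trans (coeff-+ p q n)
                  (trans (+-cong (at e n) (at f n)) (sym (coeff-+ p′ q′ n)))
              }
            ; assoc = λ p q r → mk≈ λ n →
                trans (coeff-+ (p +ₚ q) r n)
                (trans (+-congʳ (coeff-+ p q n))
                (trans (+-assoc _ _ _)
                (trans (+-congˡ (sym (coeff-+ q r n)))
                       (sym (coeff-+ p (q +ₚ r) n)))))
            }
          ; identity = (λ p → mk≈ λ _ → refl)
                     , (λ p → mk≈ λ n → trans (coeff-+ p [] n) (+-identityʳ _))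
          }
        ; inverse = (λ p → mk≈ λ n →
                       trans (coeff-+ (-ₚ p) p n)
                       (trans (+-congʳ (coeff-neg p n)) (-‿inverseˡ _)))
                  , (λ p → mk≈ λ n →
                       trans (coeff-+ p (-ₚ p) n)
                       (trans (+-congˡ (coeff-neg p n)) (-‿inverseʳ _)))
        ; ⁻¹-cong = λ {p} {q} e → mk≈ λ n →
            trans (coeff-neg p n) (trans (-‿cong (at e n)) (sym (coeff-neg q n)))
        }
      ; comm = λ p q → mk≈ λ n →
          trans (coeff-+ p q n) (trans (+-comm _ _) (sym (coeff-+ q p n)))
      }
    }

  private
    module A = AbelianGroup +ₚ-abelianGroup
    module CS = Algebra.Properties.CommutativeSemigroup A.commutativeSemigroup
    open Relation.Binary.Reasoning.Setoid A.setoid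

    ∷-cong : ∀ {a b p q} → a ≈ b → p ≈ₚ q → (a ∷ p) ≈ₚ (b ∷ q)
    ∷-cong e f = mk≈ λ { zero → e ; (suc n) → at f n }

    0∷0≈0 : (0# ∷ []) ≈ₚ []
    0∷0≈0 = mk≈ λ { zero → refl ; (suc n) → refl }

    0∷-+ : ∀ p q → (0# ∷ p +ₚ q) ≈ₚ (0# ∷ p) +ₚ (0# ∷ q)
    0∷-+ p q = ∷-cong (sym (+-identityˡ 0#)) A.refl

    ·-cong : ∀ a {p q} → p ≈ₚ q → a · p ≈ₚ a · q
    ·-cong a {p} {q} e = mk≈ λ n →
      trans (coeff-· a p n) (trans (*-congˡ (at e n)) (sym (coeff-· a q n)))

    ·-+ : ∀ a p q → a · (p +ₚ q) ≈ₚ a · p +ₚ a · q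
    ·-+ a p q = mk≈ λ n →
      trans (coeff-· a (p +ₚ q) n)
      (trans (*-congˡ (coeff-+ p q n))
      (trans (distribˡ _ _ _)
      (trans (+-cong (sym (coeff-· a p n)) (sym (coeff-· a q n)))
             (sym (coeff-+ (a · p) (a · q) n)))))

    ·-· : ∀ a b p → (a * b) · p ≈ₚ a · (b · p)
    ·-· a b p = mk≈ λ n →
      trans (coeff-· (a * b) p n)
      (trans (*-assoc _ _ _)
      (trans (*-congˡ (sym (coeff-· b p n))) (sym (coeff-· a (b · p) n))))

    0·p : ∀ p → 0# · p ≈ₚ []
    0·p p = mk≈ λ n → trans (coeff-· 0# p n) (zeroˡ _)

    1·p : ∀ p → 1# · p ≈ₚ p
    1·p p = mk≈ λ n → trans (coeff-· 1# p n) (*-identityˡ _)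

    *ₚ-congˡ : ∀ p {q r} → q ≈ₚ r → p *ₚ q ≈ₚ p *ₚ r
    *ₚ-congˡ []      e = A.refl
    *ₚ-congˡ (a ∷ p) e = A.∙-cong (·-cong a e) (∷-cong refl (*ₚ-congˡ p e))

    *ₚ-distribˡ : ∀ p q r → p *ₚ (q +ₚ r) ≈ₚ p *ₚ q +ₚ p *ₚ r
    *ₚ-distribˡ []      q r = A.refl
    *ₚ-distribˡ (a ∷ p) q r = begin
      a · (q +ₚ r) +ₚ (0# ∷ p *ₚ (q +ₚ r))
        ≈⟨ A.∙-cong (·-+ a q r) (A.trans (∷-cong refl (*ₚ-distribˡ p q r)) (0∷-+ (p *ₚ q) (p *ₚ r))) ⟩
      (a · q +ₚ a · r) +ₚ ((0# ∷ p *ₚ q) +ₚ (0# ∷ p *ₚ r))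
        ≈⟨ CS.interchange (a · q) (a · r) _ _ ⟩
      (a · q +ₚ (0# ∷ p *ₚ q)) +ₚ (a · r +ₚ (0# ∷ p *ₚ r)) ∎

    *ₚ-zeroʳ : ∀ p → p *ₚ [] ≈ₚ []
    *ₚ-zeroʳ []      = A.refl
    *ₚ-zeroʳ (a ∷ p) = A.trans (∷-cong refl (*ₚ-zeroʳ p)) 0∷0≈0

    *ₚ-∷ : ∀ p b q → p *ₚ (b ∷ q) ≈ₚ b · p +ₚ (0# ∷ p *ₚ q)
    *ₚ-∷ []      b q = A.sym 0∷0≈0
    *ₚ-∷ (a ∷ p) b q = ∷-cong (+-congʳ (*-comm a b)) (begin
      a · q +ₚ p *ₚ (b ∷ q)               ≈⟨ A.∙-congˡ {a · q} (*ₚ-∷ p b q) ⟩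
      a · q +ₚ (b · p +ₚ (0# ∷ p *ₚ q))   ≈⟨ CS.x∙yz≈y∙xz (a · q) (b · p) _ ⟩
      b · p +ₚ (a · q +ₚ (0# ∷ p *ₚ q))   ∎)

    *ₚ-comm : ∀ p q → p *ₚ q ≈ₚ q *ₚ p
    *ₚ-comm []      q = A.sym (*ₚ-zeroʳ q)
    *ₚ-comm (a ∷ p) q = A.trans
      (A.∙-congˡ {a · q} (∷-cong refl (*ₚ-comm p q)))
      (A.sym (*ₚ-∷ q a p))

    *ₚ-cong : ∀ {p p′ q q′} → p ≈ₚ p′ → q ≈ₚ q′ → p *ₚ q ≈ₚ p′ *ₚ q′
    *ₚ-cong {p} {p′} {q} {q′} e f = begin
      p *ₚ q    ≈⟨ *ₚ-congˡ p f ⟩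
      p *ₚ q′   ≈⟨ *ₚ-comm p q′ ⟩
      q′ *ₚ p   ≈⟨ *ₚ-congˡ q′ e ⟩
      q′ *ₚ p′  ≈⟨ *ₚ-comm q′ p′ ⟩
      p′ *ₚ q′  ∎

    *ₚ-distribʳ : ∀ r p q → (p +ₚ q) *ₚ r ≈ₚ p *ₚ r +ₚ q *ₚ r
    *ₚ-distribʳ r p q = begin
      (p +ₚ q) *ₚ r      ≈⟨ *ₚ-comm (p +ₚ q) r ⟩
      r *ₚ (p +ₚ q)      ≈⟨ *ₚ-distribˡ r p q ⟩
      r *ₚ p +ₚ r *ₚ q   ≈⟨ A.∙-cong (*ₚ-comm r p) (*ₚ-comm r q) ⟩
      p *ₚ r +ₚ q *ₚ r   ∎

    ·-* : ∀ a p q → (a · p) *ₚ q ≈ₚ a · (p *ₚ q)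
    ·-* a []      q = A.refl
    ·-* a (b ∷ p) q = begin
      (a * b) · q +ₚ (0# ∷ (a · p) *ₚ q)
        ≈⟨ A.∙-cong (·-· a b q) (∷-cong (sym (zeroʳ a)) (·-* a p q)) ⟩
      a · (b · q) +ₚ a · (0# ∷ p *ₚ q)
        ≈⟨ ·-+ a (b · q) _ ⟨
      a · (b · q +ₚ (0# ∷ p *ₚ q)) ∎

    *ₚ-assoc : ∀ p q r → (p *ₚ q) *ₚ r ≈ₚ p *ₚ (q *ₚ r)
    *ₚ-assoc []      q r = A.refl
    *ₚ-assoc (a ∷ p) q r = begin
      (a · q +ₚ (0# ∷ p *ₚ q)) *ₚ r
        ≈⟨ *ₚ-distribʳ r (a · q) (0# ∷ p *ₚ q) ⟩
      (a · q) *ₚ r +ₚ (0# · r +ₚ (0# ∷ (p *ₚ q) *ₚ r))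
        ≈⟨ A.∙-cong (·-* a q r) (A.∙-cong (0·p r) (∷-cong refl (*ₚ-assoc p q r))) ⟩
      a · (q *ₚ r) +ₚ (0# ∷ p *ₚ (q *ₚ r)) ∎

    *ₚ-identityˡ : ∀ p → 1ₚ *ₚ p ≈ₚ p
    *ₚ-identityˡ p = begin
      1# · p +ₚ (0# ∷ [])  ≈⟨ A.∙-cong (1·p p) 0∷0≈0 ⟩
      p +ₚ []              ≈⟨ A.identityʳ p ⟩
      p                    ∎

  polynomialRing : CommutativeRing c ℓ
  polynomialRing = record
    { Carrier = Poly ; _≈_ = _≈ₚ_
    ; _+_ = _+ₚ_ ; _*_ = _*ₚ_ ; -_ = -ₚ_ ; 0# = 0ₚ ; 1# = 1ₚ
    ; isCommutativeRing = record
      { isRing = record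
        { +-isAbelianGroup = A.isAbelianGroup
        ; *-cong     = *ₚ-cong
        ; *-assoc    = *ₚ-assoc
        ; *-identity = *ₚ-identityˡ
                     , (λ p → A.trans (*ₚ-comm p 1ₚ) (*ₚ-identityˡ p))
        ; distrib    = *ₚ-distribˡ , *ₚ-distribʳ
        }
      ; *-comm = *ₚ-comm
      }
    }

open Polynomial using (polynomialRing)

-- ℚ[m,t] is taken to be (ℚ[m])[t].

ℚ[m] ℚ[m,t] : CommutativeRing _ _
ℚ[m]   = polynomialRing ℚ-commutativeRing
ℚ[m,t] = polynomialRing ℚ[m]

𝐦 𝐭 : CommutativeRing.Carrier ℚ[m,t]
𝐦 = Polynomial.constant ℚ[m] (Polynomial.X ℚ-commutativeRing)
𝐭 = Polynomial.X ℚ[m]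

powerSum : ∀ {c ℓ} (R : CommutativeRing c ℓ) →
           ℕ → List (CommutativeRing.Carrier R) → CommutativeRing.Carrier R
powerSum R r zs = foldr _+_ 0# (map (_^ r) zs)
  where
  open CommutativeRing R
  open Algebra.Properties.Semiring.Exp semiring using (_^_)

-- The formulas make sense in any commutative ring, so that they can be read
-- both at rational numbers and at the indeterminates of ℚ[m,t].

module Solution {c ℓ} (R : CommutativeRing c ℓ) (m t : CommutativeRing.Carrier R) where

  open CommutativeRing R
  open Algebra.Properties.Semiring.Exp semiring using (_^_)
  open Algebra.Properties.Semiring.Mult semiring using (_×_)

  private
    instance
      trivial : ∀ {a} → ⊤ {a}
      trivial = tt

      ℕ-number : Number ℕ
      ℕ-number = record { Constraint = λ _ → ⊤ ; fromNat = λ n → n }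

      -- The numeral n denotes the n-fold sum 1# + ⋯ + 1#.
      R-number : Number Carrier
      R-number = record { Constraint = λ _ → ⊤ ; fromNat = λ n → n × 1# }

  x₁ x₂ x₃ x₄ x₅ x₆ y₁ y₂ y₃ y₄ y₅ y₆ : Carrier

  x₁ = 2 * m ^ 2 - 6 * t * (t - 2) * m + 6 * (t - 1) * (t + 2) * (3 * t - 2)
  x₂ = m ^ 2 * t + 16 * (t - 1) * m - 3 * t * (t + 2) * (3 * t - 2)
  x₃ = (2 * t - 2) * m ^ 2 - 2 * (3 * t ^ 2 - 4 * t + 4) * m - 6 * (t + 2) * (3 * t - 2)
  x₄ = - x₃
  x₅ = - x₂
  x₆ = - x₁

  y₁ = (2 * t - 2) * m ^ 2 - 6 * t * (t - 2) * m + 6 * (t + 2) * (3 * t - 2)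
  y₂ = m ^ 2 * t - 16 * (t - 1) * m - 3 * t * (t + 2) * (3 * t - 2)
  y₃ = 2 * m ^ 2 + 2 * (3 * t ^ 2 - 4 * t + 4) * m - 6 * (t - 1) * (t + 2) * (3 * t - 2)
  y₄ = - y₃
  y₅ = - y₂
  y₆ = - y₁

  xs ys : List Carrier
  xs = x₁ ∷ x₂ ∷ x₃ ∷ x₄ ∷ x₅ ∷ x₆ ∷ []
  ys = y₁ ∷ y₂ ∷ y₃ ∷ y₄ ∷ y₅ ∷ y₆ ∷ []

open Solution public using (xs; ys)

{-# OPTIONS --safe #-}
module Submission where

open import Defs
open import Algebra.Bundles using (CommutativeRing)
open import Data.List.Relation.Binary.Permutation.Setoid (CommutativeRing.setoid ℚ[m,t]) using (_↭_)
open import Data.Nat using (ℕ; _≤_)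
open import Data.Product using (_×_)
open import Data.Rational using (ℚ)
open import Relation.Binary.PropositionalEquality using (_≡_)
open import Relation.Nullary using (¬_)

import Algebra.Properties.AbelianGroup
import Algebra.Properties.Ring
import Algebra.Properties.Semiring.Exp
import Algebra.Properties.Semiring.Mult
import Algebra.Solver.Ring
open import Algebra.Solver.Ring.AlmostCommutativeRing using (_-Raw-AlmostCommutative⟶_; fromCommutativeRing)
open import Data.Integer using (ℤ; +_; -[1+_]; _⊖_; +-*-rawRing)
open import Data.Integer.Properties using ([1+m]⊖[1+n]≡m⊖n)
import Data.Integer as ℤ
import Data.Integer.Properties as ℤ
open import Data.List using (List; []; _∷_)
open import Data.List.Relation.Unary.Any using (here; there)
open import Data.List.Membership.Setoid (CommutativeRing.setoid ℚ[m,t]) using (_∈_)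
open import Data.List.Relation.Binary.Permutation.Setoid.Properties (CommutativeRing.setoid ℚ[m,t]) using (∈-resp-↭)
open import Data.Maybe using (Maybe) renaming (map to mapMaybe)
open import Data.Nat using (zero; suc; s≤s)
open import Data.Product using (_,_)
open import Function using (case_of_)
import Data.Nat as ℕ
import Data.Nat.Properties as ℕ
import Relation.Binary.PropositionalEquality as ≡
import Relation.Binary.Reasoning.Setoid
open import Relation.Nullary.Decidable using (dec⇒maybe)

-- Each of the two multisets has the form a, b, c, -c, -b, -a. Its odd power sums cancel in pairs,
-- and its even ones are twice the sum over a, b, c, so only r = 2 and r = 4 have content:
-- `equal-squares` and `equal-fourth-powers`. These are identities between polynomials in m and t
-- with integer coefficients, so normalisation proves them over every commutative ring; they are
-- then read over the rationals. For nontriviality, a permutation of the generic solution would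
-- place `x₁` among the entries of `ys`. `x₁∉ys` excludes this by exhibiting, for each entry, a
-- monomial at which the coefficients differ.

-- Equality in R need not be decidable, so the ring solver takes its
-- coefficients in ℤ; + n is sent to n × 1#, the reading of numerals in Solution.

module IntegerCoefficients {c ℓ} (R : CommutativeRing c ℓ) where

  open CommutativeRing R
  open Algebra.Properties.AbelianGroup +-abelianGroup using (⁻¹-∙-comm; ⁻¹-involutive; ε⁻¹≈ε)
  open Algebra.Properties.Ring ring using (-‿distribˡ-*)
  open Algebra.Properties.Semiring.Mult semiring renaming (_×_ to _·_)
  open Relation.Binary.Reasoning.Setoid setoid

  fromℤ : ℤ → Carrier
  fromℤ (+ n)    = n · 1#
  fromℤ -[1+ n ] = - (suc n · 1#)

  -- This is the mixed-sign case of additivity. Since `_⊖_` strips a successor from both arguments,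
  -- the induction step inserts `1# - 1#` and moves one half to each side.
  fromℤ-⊖ : ∀ m n → fromℤ (m ⊖ n) ≈ m · 1# - n · 1#
  fromℤ-⊖ m       zero    = sym (trans (+-congˡ ε⁻¹≈ε) (+-identityʳ _))
  fromℤ-⊖ zero    (suc n) = sym (+-identityˡ _)
  fromℤ-⊖ (suc m) (suc n) = begin
    fromℤ (suc m ⊖ suc n)                 ≡⟨ ≡.cong fromℤ ([1+m]⊖[1+n]≡m⊖n m n) ⟩
    fromℤ (m ⊖ n)                         ≈⟨ fromℤ-⊖ m n ⟩
    a - b                                 ≈⟨ +-congʳ (+-identityˡ a) ⟨
    (0# + a) - b                          ≈⟨ +-congʳ (+-congʳ (-‿inverseʳ 1#)) ⟨
    (1# - 1#) + a - b                     ≈⟨ +-congʳ (+-assoc 1# (- 1#) a) ⟩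
    1# + (- 1# + a) - b                   ≈⟨ +-congʳ (+-congˡ (+-comm (- 1#) a)) ⟩
    1# + (a - 1#) - b                     ≈⟨ +-congʳ (+-assoc 1# a (- 1#)) ⟨
    (1# + a) - 1# - b                     ≈⟨ +-assoc (1# + a) (- 1#) (- b) ⟩
    (1# + a) + (- 1# - b)                 ≈⟨ +-congˡ (⁻¹-∙-comm 1# b) ⟩
    (1# + a) - (1# + b)                   ∎
    where
    a b : Carrier
    a = m · 1#
    b = n · 1#

  fromℤ-+ : ∀ i j → fromℤ (i ℤ.+ j) ≈ fromℤ i + fromℤ j
  fromℤ-+ (+ m)    (+ n)    = ×-homo-+ 1# m n
  fromℤ-+ (+ m)    -[1+ n ] = fromℤ-⊖ m (suc n)
  fromℤ-+ -[1+ m ] (+ n)    = trans (fromℤ-⊖ n (suc m)) (+-comm _ _)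
  fromℤ-+ -[1+ m ] -[1+ n ] = begin
    - (suc (suc (m ℕ.+ n)) · 1#)          ≡⟨ ≡.cong (λ k → - (suc k · 1#)) (ℕ.+-suc m n) ⟨
    - ((suc m ℕ.+ suc n) · 1#)            ≈⟨ -‿cong (×-homo-+ 1# (suc m) (suc n)) ⟩
    - (suc m · 1# + suc n · 1#)           ≈⟨ ⁻¹-∙-comm _ _ ⟨
    - (suc m · 1#) - suc n · 1#           ∎

  fromℤ-neg : ∀ i → fromℤ (ℤ.- i) ≈ - fromℤ i
  fromℤ-neg (+ zero)  = sym ε⁻¹≈ε
  fromℤ-neg (+ suc n) = refl
  fromℤ-neg -[1+ n ]  = sym (⁻¹-involutive _)

  -- A nonnegative left factor allows induction by repeated addition of `j`; the negative case of
  -- `fromℤ-*` then follows by negation.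
  fromℤ-+* : ∀ m j → fromℤ (+ m ℤ.* j) ≈ m · 1# * fromℤ j
  fromℤ-+* zero    j = sym (zeroˡ _)
  fromℤ-+* (suc m) j = begin
    fromℤ (+ suc m ℤ.* j)                 ≡⟨ ≡.cong fromℤ (ℤ.suc-* (+ m) j) ⟩
    fromℤ (j ℤ.+ + m ℤ.* j)               ≈⟨ fromℤ-+ j (+ m ℤ.* j) ⟩
    fromℤ j + fromℤ (+ m ℤ.* j)           ≈⟨ +-cong (sym (*-identityˡ _)) (fromℤ-+* m j) ⟩
    1# * fromℤ j + m · 1# * fromℤ j       ≈⟨ distribʳ _ _ _ ⟨
    suc m · 1# * fromℤ j                  ∎

  fromℤ-* : ∀ i j → fromℤ (i ℤ.* j) ≈ fromℤ i * fromℤ j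
  fromℤ-* (+ m)    j = fromℤ-+* m j
  fromℤ-* -[1+ m ] j = begin
    fromℤ (-[1+ m ] ℤ.* j)                ≡⟨ ≡.cong fromℤ (ℤ.neg-distribˡ-* (+ suc m) j) ⟨
    fromℤ (ℤ.- (+ suc m ℤ.* j))           ≈⟨ fromℤ-neg (+ suc m ℤ.* j) ⟩
    - fromℤ (+ suc m ℤ.* j)               ≈⟨ -‿cong (fromℤ-+* (suc m) j) ⟩
    - (suc m · 1# * fromℤ j)              ≈⟨ -‿distribˡ-* _ _ ⟩
    - (suc m · 1#) * fromℤ j              ∎

  homomorphism : +-*-rawRing -Raw-AlmostCommutative⟶ fromCommutativeRing R
  homomorphism = record
    { ⟦_⟧    = fromℤ
    ; +-homo = fromℤ-+
    ; *-homo = fromℤ-*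
    ; -‿homo = fromℤ-neg
    ; 0-homo = refl
    ; 1-homo = +-identityʳ 1#
    }

  -- Only a positive answer is conclusive: in positive characteristic distinct integers can have the
  -- same image.
  fromℤ-≟ : ∀ i j → Maybe (fromℤ i ≈ fromℤ j)
  fromℤ-≟ i j = mapMaybe (λ e → reflexive (≡.cong fromℤ e)) (dec⇒maybe (i ℤ.≟ j))

  module Solver = Algebra.Solver.Ring +-*-rawRing (fromCommutativeRing R) homomorphism fromℤ-≟

module PowerSums {c ℓ} (R : CommutativeRing c ℓ) where

  open CommutativeRing R
  open Algebra.Properties.AbelianGroup +-abelianGroup using (x∙y⁻¹≈ε⇒x≈y)
  open Algebra.Properties.Semiring.Exp semiring using (_^_)
  open IntegerCoefficients R using (module Solver)
  open Solver
  open Relation.Binary.Reasoning.Setoid setoid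

  private
    # : ∀ {n} → ℕ → Polynomial n
    # k = con (+ k)

    -- The nesting and the final zero copy the unfolding of `powerSum` on `±[ a , b , c ]`, so that
    -- the solver's goal matches definitionally.
    signedPowerSum : ∀ {n} → ℕ → (a b c : Polynomial n) → Polynomial n
    signedPowerSum r a b c =
      a :^ r :+ (b :^ r :+ (c :^ r :+ ((:- c) :^ r :+ ((:- b) :^ r :+ ((:- a) :^ r :+ # 0)))))

    powerSum₃ : ∀ {n} → ℕ → (a b c : Polynomial n) → Polynomial n
    powerSum₃ r a b c = a :^ r :+ b :^ r :+ c :^ r

  -- The order makes `xs` and `ys` instances by definition, as x₄ = -x₃, x₅ = -x₂, x₆ = -x₁, and
  -- likewise for y.
  ±[_,_,_] : Carrier → Carrier → Carrier → List Carrier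
  ±[ a , b , c ] = a ∷ b ∷ c ∷ - c ∷ - b ∷ - a ∷ []

  powerSum-±-1 : ∀ a b c → powerSum R 1 ±[ a , b , c ] ≈ 0#
  powerSum-±-1 = solve 3 (λ a b c → signedPowerSum 1 a b c := # 0) refl

  powerSum-±-3 : ∀ a b c → powerSum R 3 ±[ a , b , c ] ≈ 0#
  powerSum-±-3 = solve 3 (λ a b c → signedPowerSum 3 a b c := # 0) refl

  powerSum-±-5 : ∀ a b c → powerSum R 5 ±[ a , b , c ] ≈ 0#
  powerSum-±-5 = solve 3 (λ a b c → signedPowerSum 5 a b c := # 0) refl

  powerSum-±-2 : ∀ a b c → let s = a ^ 2 + b ^ 2 + c ^ 2 in
                 powerSum R 2 ±[ a , b , c ] ≈ s + s
  powerSum-±-2 = solve 3 (λ a b c →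
    signedPowerSum 2 a b c := powerSum₃ 2 a b c :+ powerSum₃ 2 a b c) refl

  powerSum-±-4 : ∀ a b c → let s = a ^ 4 + b ^ 4 + c ^ 4 in
                 powerSum R 4 ±[ a , b , c ] ≈ s + s
  powerSum-±-4 = solve 3 (λ a b c →
    signedPowerSum 4 a b c := powerSum₃ 4 a b c :+ powerSum₃ 4 a b c) refl

  module _ (m t : Carrier) where

    open Solution R m t hiding (xs; ys)

    private
      -- The twelve formulas' first halves as solver syntax: `# k` evaluates to `k × 1#`, exactly
      -- the reading of numerals in `Solution`.
      module Formulas (m t : Polynomial 2) where
        X₁ X₂ X₃ Y₁ Y₂ Y₃ : Polynomial 2
        X₁ = # 2 :* m :^ 2 :- # 6 :* t :* (t :- # 2) :* m :+ # 6 :* (t :- # 1) :* (t :+ # 2) :* (# 3 :* t :- # 2)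
        X₂ = m :^ 2 :* t :+ # 16 :* (t :- # 1) :* m :- # 3 :* t :* (t :+ # 2) :* (# 3 :* t :- # 2)
        X₃ = (# 2 :* t :- # 2) :* m :^ 2 :- # 2 :* (# 3 :* t :^ 2 :- # 4 :* t :+ # 4) :* m :- # 6 :* (t :+ # 2) :* (# 3 :* t :- # 2)
        Y₁ = (# 2 :* t :- # 2) :* m :^ 2 :- # 6 :* t :* (t :- # 2) :* m :+ # 6 :* (t :+ # 2) :* (# 3 :* t :- # 2)
        Y₂ = m :^ 2 :* t :- # 16 :* (t :- # 1) :* m :- # 3 :* t :* (t :+ # 2) :* (# 3 :* t :- # 2)
        Y₃ = # 2 :* m :^ 2 :+ # 2 :* (# 3 :* t :^ 2 :- # 4 :* t :+ # 4) :* m :- # 6 :* (t :- # 1) :* (t :+ # 2) :* (# 3 :* t :- # 2)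

    -- The solver is applied to a difference equal to zero, so that no large
    -- integer coefficient k is ever unfolded to the k-fold sum of 1#.

    equal-squares : x₁ ^ 2 + x₂ ^ 2 + x₃ ^ 2 ≈ y₁ ^ 2 + y₂ ^ 2 + y₃ ^ 2
    equal-squares = x∙y⁻¹≈ε⇒x≈y _ _ (solve 2 (λ m t → let open Formulas m t in
      powerSum₃ 2 X₁ X₂ X₃ :- powerSum₃ 2 Y₁ Y₂ Y₃ := # 0) refl m t)

    equal-fourth-powers : x₁ ^ 4 + x₂ ^ 4 + x₃ ^ 4 ≈ y₁ ^ 4 + y₂ ^ 4 + y₃ ^ 4
    equal-fourth-powers = x∙y⁻¹≈ε⇒x≈y _ _ (solve 2 (λ m t → let open Formulas m t in
      powerSum₃ 4 X₁ X₂ X₃ :- powerSum₃ 4 Y₁ Y₂ Y₃ := # 0) refl m t)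

    equal-powerSums : ∀ r → 1 ≤ r → r ≤ 5 → powerSum R r (xs R m t) ≈ powerSum R r (ys R m t)
    equal-powerSums 1 _ _ = trans (powerSum-±-1 x₁ x₂ x₃) (sym (powerSum-±-1 y₁ y₂ y₃))
    equal-powerSums 2 _ _ = begin
      powerSum R 2 (xs R m t)  ≈⟨ powerSum-±-2 x₁ x₂ x₃ ⟩
      _                        ≈⟨ +-cong equal-squares equal-squares ⟩
      _                        ≈⟨ powerSum-±-2 y₁ y₂ y₃ ⟨
      powerSum R 2 (ys R m t)  ∎
    equal-powerSums 3 _ _ = trans (powerSum-±-3 x₁ x₂ x₃) (sym (powerSum-±-3 y₁ y₂ y₃))
    equal-powerSums 4 _ _ = begin
      powerSum R 4 (xs R m t)  ≈⟨ powerSum-±-4 x₁ x₂ x₃ ⟩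
      _                        ≈⟨ +-cong equal-fourth-powers equal-fourth-powers ⟩
      _                        ≈⟨ powerSum-±-4 y₁ y₂ y₃ ⟨
      powerSum R 4 (ys R m t)  ∎
    equal-powerSums 5 _ _ = trans (powerSum-±-5 x₁ x₂ x₃) (sym (powerSum-±-5 y₁ y₂ y₃))
    equal-powerSums (suc (suc (suc (suc (suc (suc _)))))) _ (s≤s (s≤s (s≤s (s≤s (s≤s ())))))

module ℚ[m]-coefficients = Polynomial ℚ-commutativeRing
module ℚ[m,t]-coefficients = Polynomial ℚ[m]

-- coefficient p i j is the coefficient of mⁱtʲ.

coefficient : CommutativeRing.Carrier ℚ[m,t] → ℕ → ℕ → ℚ
coefficient p i j = ℚ[m]-coefficients.coeff (ℚ[m,t]-coefficients.coeff p j) i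

coefficient-cong : ∀ {p q} → CommutativeRing._≈_ ℚ[m,t] p q → ∀ i j → coefficient p i j ≡ coefficient q i j
coefficient-cong e i j = ℚ[m]-coefficients.at (ℚ[m,t]-coefficients.at e j) i

module Generic = Solution ℚ[m,t] 𝐦 𝐭

-- In `x₁` the coefficient of m² is the constant 2, while in y₁, y₂, y₄, y₅ its part free of t is
-- -2, 0, -2, 0. Each comparison reduces to two distinct rational literals.
x₁∉ys : ¬ (Generic.x₁ ∈ Generic.ys)
x₁∉ys (here e) = case coefficient-cong e 2 0 of λ ()
x₁∉ys (there (here e)) = case coefficient-cong e 2 0 of λ ()
-- y₃ also has 2m², so the coefficient of m is compared: 0 against 8.
x₁∉ys (there (there (here e))) = case coefficient-cong e 1 0 of λ ()
x₁∉ys (there (there (there (here e)))) = case coefficient-cong e 2 0 of λ ()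
x₁∉ys (there (there (there (there (here e))))) = case coefficient-cong e 2 0 of λ ()
-- y₆ has (2 - 2t)m², which differs from 2m² only at m²t.
x₁∉ys (there (there (there (there (there (here e)))))) = case coefficient-cong e 2 1 of λ ()

mainTheorem4 : ((m t : ℚ) (r : ℕ) → 1 ≤ r → r ≤ 5 →
    powerSum ℚ-commutativeRing r (xs ℚ-commutativeRing m t)
    ≡ powerSum ℚ-commutativeRing r (ys ℚ-commutativeRing m t))
    × ¬ (xs ℚ[m,t] 𝐦 𝐭 ↭ ys ℚ[m,t] 𝐦 𝐭)
mainTheorem4 = PowerSums.equal-powerSums ℚ-commutativeRing
             , λ xs↭ys → x₁∉ys (∈-resp-↭ xs↭ys (here (CommutativeRing.refl ℚ[m,t])))
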